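{- (i) For every integer $t\ge 1$, $rrsat(n,K_{t+2})=\Omega(n^{3/2})$; that is, there is $c=c_t>0$ such that $rrsat(n,K_{t+2})\ge c\,n^{3/2}$ for all sufficiently large $n$. (ii) For every integer $t\ge 1$ there is a constant $C_t$ depending only on $t$ such that $\liminf_{n\to\infty}\frac{rrsat(n,K_{t+2})}{n^{3/2}}\le C_t$.
   Context: All graphs are finite and simple. For a graph $F$ and integer $n$, $rrsat(n,F)$ denotes the smallest number of edges in a regular $n$-vertex graph $G$ that contains no copy of $F$ and such that every regular $n$-vertex graph on the same vertex set that properly contains $G$ (i.e. is obtained from $G$ by adding at least one edge) contains a copy of $F$. $K_{t+2}$ is the complete graph on $t+2$ vertices. -}

module Defs where

open import Data.Nat using (ℕ; zero; suc; _+_; _<ᵇ_)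
open import Data.Bool using (Bool; true; false; if_then_else_; _∧_)
open import Data.Fin using (Fin; toℕ)
import Data.Fin as F
open import Data.Product using (Σ; ∃; _×_)
open import Relation.Binary.PropositionalEquality using (_≡_; _≢_)
open import Function.Definitions using (Injective)

sumFin : (n : ℕ) → (Fin n → ℕ) → ℕ
sumFin zero    f = 0
sumFin (suc n) f = f F.zero + sumFin n (λ i → f (F.suc i))

countFin : (n : ℕ) → (Fin n → Bool) → ℕ
countFin n p = sumFin n (λ i → if p i then 1 else 0)

record Graph (n : ℕ) : Set where
  field
    adj    : Fin n → Fin n → Bool
    irrefl : ∀ i → adj i i ≡ false
    sym    : ∀ i j → adj i j ≡ adj j i
open Graph public

degree : {n : ℕ} → Graph n → Fin n → ℕ
degree {n} G v = countFin n (adj G v)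

edges : {n : ℕ} → Graph n → ℕ
edges {n} G = sumFin n (λ i → countFin n (λ j → (toℕ i <ᵇ toℕ j) ∧ adj G i j))

Regular : {n : ℕ} → Graph n → Set
Regular {n} G = ∃ λ d → ∀ (v : Fin n) → degree G v ≡ d

ContainsK : {n : ℕ} → ℕ → Graph n → Set
ContainsK {n} k G =
  Σ (Fin k → Fin n) λ f → Injective _≡_ _≡_ f × (∀ a b → a ≢ b → adj G (f a) (f b) ≡ true)

ProperSupergraph : {n : ℕ} → Graph n → Graph n → Set
ProperSupergraph {n} G H =
  (∀ i j → adj G i j ≡ true → adj H i j ≡ true)
  × (Σ (Fin n) λ i → Σ (Fin n) λ j → adj G i j ≡ false × adj H i j ≡ true)

RegSat : {n : ℕ} → ℕ → Graph n → Set
RegSat {n} k G =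
  Regular G × (ContainsK k G → ⊥') × (∀ (H : Graph n) → Regular H → ProperSupergraph G H → ContainsK k H)
  where
    open import Data.Empty using () renaming (⊥ to ⊥')

IsRRSat : ℕ → ℕ → ℕ → Set
IsRRSat n k m =
  (Σ (Graph n) λ G → RegSat k G × edges G ≡ m)
  × (∀ (G : Graph n) → RegSat k G → m Data.Nat.≤ edges G)
  where import Data.Nat

{-# OPTIONS --safe #-}
module Submission where

-- Lower bound: let G be d-regular and regular-saturated. If n > 12 (d + 1)²,
-- the vertices can be placed on a cycle so that any two at cyclic distance at
-- most 3 are at distance greater than 2 in G: starting from any placement, each
-- position in turn is repaired by exchanging its vertex with a suitable one.
-- Adding this cycle to G gives a (d + 2)-regular graph in which no new edge lies
-- in a triangle, hence without new cliques K_{t+2}. So n ≤ 12 (d + 1)².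
--
-- Upper bound: there is a regular K_{t+2}-free graph on [q]² × [t + 1]² in which
-- any two vertices differing in both of the first two coordinates have K_t in
-- their common neighbourhood. In a maximal regular K_{t+2}-free extension every
-- edge therefore stays in a row or column of the q × q grid, so the degree is at
-- most 2 q (t + 1)² while n = q² (t + 1)².

open import Defs hiding (sym)
open import Data.Nat using (ℕ; zero; suc; _+_; _*_; _^_; _∸_; _≤_; _<_; z≤n; s≤s; _<ᵇ_; NonZero; _%_)
open import Data.Product using (Σ; _×_; ∃; _,_; proj₁; proj₂)
open import Data.Bool using (Bool; true; false; if_then_else_; _∧_; _∨_; not)
open import Data.Bool.Properties using (∧-zeroʳ; ∨-comm)
open import Data.Empty using (⊥; ⊥-elim)
open import Data.Fin using (Fin; zero; suc; toℕ; fromℕ<; _↑ˡ_; _↑ʳ_; combine; remQuot; punchIn)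
open import Data.Fin.Permutation using (Permutation′; permutation; transpose; flip; _∘ₚ_; _⟨$⟩ʳ_; _⟨$⟩ˡ_; inverseˡ; inverseʳ)
  renaming (id to idₚ)
open import Data.Fin.Properties using (_≟_; any?; all?; toℕ<n; toℕ-injective; toℕ-fromℕ<; remQuot-combine;
  pigeonhole; ¬∀⟶∃¬; punchInᵢ≢i; punchIn-injective)
open import Data.Nat.DivMod using (_mod_; m%n<n; m<n⇒m%n≡m; [m+n]%n≡m%n; %-distribˡ-+; m%n%n≡m%n)
open import Data.Nat.Properties hiding (_≟_)
open import Data.Nat.Tactic.RingSolver using (solve-∀)
open import Data.Sum using (_⊎_; inj₁; inj₂)
open import Function using (_∘_)
open import Relation.Nullary using (¬_; Dec; yes; no; does; contradiction)
open import Relation.Nullary.Decidable using (dec-true; dec-false; map′; ¬?; _×-dec_; _→-dec_; decidable-stable)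
open import Relation.Binary.PropositionalEquality using (_≡_; _≢_; refl; sym; trans; cong; cong₂; subst; _≗_;
  module ≡-Reasoning)
import Data.Bool as Bool
import Data.Nat as ℕ
import Algebra.Properties.CommutativeMonoid.Sum +-0-commutativeMonoid as Sum

-- Finite sums and degree counts

⟦_⟧ : Bool → ℕ
⟦ b ⟧ = if b then 1 else 0

sumFin-cong : ∀ {n} {f g : Fin n → ℕ} → f ≗ g → sumFin n f ≡ sumFin n g
sumFin-cong {zero}  f≗g = refl
sumFin-cong {suc n} f≗g = cong₂ _+_ (f≗g zero) (sumFin-cong (f≗g ∘ suc))

sumFin≡sum : ∀ {n} (f : Fin n → ℕ) → sumFin n f ≡ Sum.sum f
sumFin≡sum {zero}  f = refl
sumFin≡sum {suc n} f = cong (f zero +_) (sumFin≡sum (f ∘ suc))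

sumFin-+ : ∀ {n} (f g : Fin n → ℕ) → sumFin n (λ i → f i + g i) ≡ sumFin n f + sumFin n g
sumFin-+ f g rewrite sumFin≡sum f | sumFin≡sum g = trans (sumFin≡sum (λ i → f i + g i)) (Sum.∑-distrib-+ f g)

sumFin-+-≤ : ∀ {n a b} (f g : Fin n → ℕ) → sumFin n f ≤ a → sumFin n g ≤ b →
  sumFin n (λ i → f i + g i) ≤ a + b
sumFin-+-≤ f g Σf≤a Σg≤b = ≤-trans (≤-reflexive (sumFin-+ f g)) (+-mono-≤ Σf≤a Σg≤b)

sumFin-swap : ∀ {m n} (f : Fin m → Fin n → ℕ) →
  sumFin m (λ i → sumFin n (f i)) ≡ sumFin n (λ j → sumFin m (λ i → f i j))
sumFin-swap {m} {n} f = begin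
  sumFin m (λ i → sumFin n (f i))          ≡⟨ sumFin-cong (λ i → sumFin≡sum (f i)) ⟩
  sumFin m (λ i → Sum.sum (f i))           ≡⟨ sumFin≡sum (λ i → Sum.sum (f i)) ⟩
  Sum.sum (λ i → Sum.sum (f i))            ≡⟨ Sum.∑-comm f ⟩
  Sum.sum (λ j → Sum.sum (λ i → f i j))    ≡⟨ sumFin≡sum (λ j → Sum.sum (λ i → f i j)) ⟨
  sumFin n (λ j → Sum.sum (λ i → f i j))   ≡⟨ sumFin-cong (λ j → sumFin≡sum (λ i → f i j)) ⟨
  sumFin n (λ j → sumFin m (λ i → f i j))  ∎
  where open ≡-Reasoning

sumFin-permute : ∀ {n} (f : Fin n → ℕ) (π : Permutation′ n) →
  sumFin n (λ i → f (π ⟨$⟩ʳ i)) ≡ sumFin n f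
sumFin-permute f π = trans (sumFin≡sum (λ i → f (π ⟨$⟩ʳ i))) (trans (sym (Sum.sum-permute f π)) (sym (sumFin≡sum f)))

sumFin-*ˡ : ∀ {n} c (f : Fin n → ℕ) → sumFin n (λ i → c * f i) ≡ c * sumFin n f
sumFin-*ˡ {zero}  c f = sym (*-zeroʳ c)
sumFin-*ˡ {suc n} c f = trans (cong (c * f zero +_) (sumFin-*ˡ c (f ∘ suc))) (sym (*-distribˡ-+ c _ _))

sumFin-const : ∀ n c → sumFin n (λ _ → c) ≡ n * c
sumFin-const zero    c = refl
sumFin-const (suc n) c = cong (c +_) (sumFin-const n c)

sumFin-mono-≤ : ∀ {n} {f g : Fin n → ℕ} → (∀ i → f i ≤ g i) → sumFin n f ≤ sumFin n g
sumFin-mono-≤ {zero}  f≤g = z≤n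
sumFin-mono-≤ {suc n} f≤g = +-mono-≤ (f≤g zero) (sumFin-mono-≤ (f≤g ∘ suc))

sumFin-mono-< : ∀ {n} {f g : Fin n → ℕ} → (∀ i → f i ≤ g i) → ∀ i → f i < g i → sumFin n f < sumFin n g
sumFin-mono-< f≤g zero    f<g = +-mono-<-≤ f<g (sumFin-mono-≤ (f≤g ∘ suc))
sumFin-mono-< f≤g (suc i) f<g = +-mono-≤-< (f≤g zero) (sumFin-mono-< (f≤g ∘ suc) i f<g)

sumFin≡0⇒≡0 : ∀ {n} (f : Fin n → ℕ) → sumFin n f ≡ 0 → ∀ i → f i ≡ 0
sumFin≡0⇒≡0 f eq zero    = m+n≡0⇒m≡0 (f zero) eq
sumFin≡0⇒≡0 f eq (suc i) = sumFin≡0⇒≡0 (f ∘ suc) (m+n≡0⇒n≡0 (f zero) eq) i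

-- Averaging: if all `n` terms were nonzero, the sum would be at least `n`.
sumFin<n⇒∃≡0 : ∀ {n} (f : Fin n → ℕ) → sumFin n f < n → ∃ λ i → f i ≡ 0
sumFin<n⇒∃≡0 {suc n} f Σf<n with f zero in eq
... | zero = zero , eq
... | suc m with i , fi≡0 ← sumFin<n⇒∃≡0 (f ∘ suc) (≤-<-trans (m≤n+m _ m) (≤-pred Σf<n)) = suc i , fi≡0

-- One index agrees with `i` and `n` do not. The weight `φ` is arbitrary so that the formula can be
-- nested, one coordinate inside another, in `count-agreement`.
sumFin-does-≟ : ∀ {n} (i : Fin (suc n)) (φ : Bool → ℕ) →
  sumFin (suc n) (λ j → φ (does (i ≟ j))) ≡ φ true + n * φ false
sumFin-does-≟ {n} zero φ = cong (φ true +_) (sumFin-const n (φ false))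
sumFin-does-≟ {suc n} (suc i) φ = begin
  φ false + sumFin (suc n) (λ j → φ (does (i ≟ j)))  ≡⟨ cong (φ false +_) (sumFin-does-≟ i φ) ⟩
  φ false + (φ true + n * φ false)                   ≡⟨ lemma (φ true) (φ false) n ⟩
  φ true + suc n * φ false                           ∎
  where
  open ≡-Reasoning
  lemma : ∀ a b n → b + (a + n * b) ≡ a + (1 + n) * b
  lemma = solve-∀

count-≟ : ∀ {n} (i : Fin n) → countFin n (λ j → does (i ≟ j)) ≡ 1
count-≟ {suc n} i = trans (sumFin-does-≟ i ⟦_⟧) (cong suc (*-zeroʳ n))

does-≟-sym : ∀ {n} (i j : Fin n) → does (i ≟ j) ≡ does (j ≟ i)
does-≟-sym i j with i ≟ j
... | yes refl = sym (dec-true (i ≟ i) refl)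
... | no  i≢j  = sym (dec-false (j ≟ i) (i≢j ∘ sym))

true≢false : true ≢ false
true≢false ()

<ᵇ-tri : ∀ m n → m ≡ n ⊎ ((m <ᵇ n) ≡ true × (n <ᵇ m) ≡ false) ⊎ ((m <ᵇ n) ≡ false × (n <ᵇ m) ≡ true)
<ᵇ-tri zero    zero    = inj₁ refl
<ᵇ-tri zero    (suc n) = inj₂ (inj₁ (refl , refl))
<ᵇ-tri (suc m) zero    = inj₂ (inj₂ (refl , refl))
<ᵇ-tri (suc m) (suc n) with <ᵇ-tri m n
... | inj₁ eq = inj₁ (cong suc eq)
... | inj₂ c  = inj₂ c

-- `edges` counts each pair from its smaller endpoint. Off the diagonal exactly one of the two
-- orders holds; on it irreflexivity makes every term vanish.
adj-split : ∀ {n} (G : Graph n) i j →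
  ⟦ adj G i j ⟧ ≡ ⟦ (toℕ i <ᵇ toℕ j) ∧ adj G i j ⟧ + ⟦ (toℕ j <ᵇ toℕ i) ∧ adj G j i ⟧
adj-split G i j with <ᵇ-tri (toℕ i) (toℕ j)
... | inj₁ i≡j with refl ← toℕ-injective i≡j rewrite irrefl G i | ∧-zeroʳ (toℕ i <ᵇ toℕ i) = refl
... | inj₂ (inj₁ (p , q)) rewrite p | q = sym (+-identityʳ _)
... | inj₂ (inj₂ (p , q)) rewrite p | q | Graph.sym G i j = refl

handshake : ∀ {n} (G : Graph n) → sumFin n (degree G) ≡ 2 * edges G
handshake {n} G = begin
  sumFin n (λ i → sumFin n (λ j → ⟦ adj G i j ⟧))              ≡⟨ sumFin-cong (λ i → sumFin-cong (adj-split G i)) ⟩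
  sumFin n (λ i → sumFin n (λ j → up i j + up j i))            ≡⟨ sumFin-cong (λ i → sumFin-+ (up i) (λ j → up j i)) ⟩
  sumFin n (λ i → sumFin n (up i) + sumFin n (λ j → up j i))   ≡⟨ sumFin-+ (λ i → sumFin n (up i)) (λ i → sumFin n (λ j → up j i)) ⟩
  edges G + sumFin n (λ i → sumFin n (λ j → up j i))           ≡⟨ cong (edges G +_) (sumFin-swap (λ i j → up j i)) ⟩
  edges G + edges G                                            ≡⟨ cong (edges G +_) (sym (+-identityʳ _)) ⟩
  2 * edges G                                                  ∎
  where
  open ≡-Reasoning
  up : Fin n → Fin n → ℕ
  up i j = ⟦ (toℕ i <ᵇ toℕ j) ∧ adj G i j ⟧

regular⇒2*edges : ∀ {n} (G : Graph n) d → (∀ v → degree G v ≡ d) → 2 * edges G ≡ n * d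
regular⇒2*edges {n} G d deg = trans (sym (handshake G)) (trans (sumFin-cong deg) (sumFin-const n d))

-- Injectivity is automatic: a repeated vertex would be adjacent to itself.
clique⇒ContainsK : ∀ {n k} (G : Graph n) (f : Fin k → Fin n) →
  (∀ a b → a ≢ b → adj G (f a) (f b) ≡ true) → ContainsK k G
clique⇒ContainsK G f clique = f , injective , clique
  where
  injective : ∀ {a b} → f a ≡ f b → a ≡ b
  injective {a} {b} fa≡fb with a ≟ b
  ... | yes a≡b = a≡b
  ... | no  a≢b = ⊥-elim (true≢false (trans (sym (clique a b a≢b))
                    (trans (cong (adj G (f a)) (sym fa≡fb)) (irrefl G (f a)))))

-- Spreading close pairs by exchanges

transpose-first : ∀ {n} (i j : Fin n) → transpose i j ⟨$⟩ʳ i ≡ j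
transpose-first i j rewrite dec-true (i ≟ i) refl = refl

transpose-second : ∀ {n} (i j : Fin n) → transpose i j ⟨$⟩ʳ j ≡ i
transpose-second i j with j ≟ i
... | yes j≡i = j≡i
... | no  _ rewrite dec-true (j ≟ j) refl = refl

transpose-other : ∀ {n} (i j k : Fin n) → k ≢ i → k ≢ j → transpose i j ⟨$⟩ʳ k ≡ k
transpose-other i j k k≢i k≢j rewrite dec-false (k ≟ i) k≢i | dec-false (k ≟ j) k≢j = refl

module _ {n m K : ℕ} (w : Fin n → Fin n → ℕ)
         (w-sym : ∀ x y → w x y ≡ w y x) (w-refl : ∀ x → w x x ≢ 0)
         (column : ∀ y → sumFin n (λ x → w x y) ≤ K)
         (D : Fin m → Permutation′ n) (D-free : ∀ j p → D j ⟨$⟩ʳ p ≢ p)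
         (large : m * (4 * K) < n) where

  -- Here `π` assigns vertices to positions and the `D j` displace positions. The application takes
  -- `walks` for `w` and the rotations by 1, 2 and 3 for `D`.
  Spread : Permutation′ n → Fin n → Set
  Spread π p = ∀ j → w (π ⟨$⟩ʳ p) (π ⟨$⟩ʳ (D j ⟨$⟩ʳ p)) ≡ 0

  column-permute : ∀ (ρ : Permutation′ n) y → sumFin n (λ q → w (ρ ⟨$⟩ʳ q) y) ≤ K
  column-permute ρ y = ≤-trans (≤-reflexive (sumFin-permute (λ x → w x y) ρ)) (column y)

  -- The pairs whose weights are summed here are those affected by exchanging
  -- the values of π at p and q.
  exchangeWeight : Permutation′ n → Fin n → Fin n → Fin m → ℕ
  exchangeWeight π p q j =
      (w (π ⟨$⟩ʳ q) (π ⟨$⟩ʳ (D j ⟨$⟩ʳ p)) + w (π ⟨$⟩ʳ q) (π ⟨$⟩ʳ (D j ⟨$⟩ˡ p)))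
    + (w (π ⟨$⟩ʳ (D j ⟨$⟩ʳ q)) (π ⟨$⟩ʳ p) + w (π ⟨$⟩ʳ (D j ⟨$⟩ˡ q)) (π ⟨$⟩ʳ p))

  -- As `q` varies, each of the four summands of `exchangeWeight` runs through a permuted column of
  -- `w`, so one displacement costs at most `4 * K` in total. All `m` of them together cost less
  -- than `n`, hence some `q` costs nothing.
  ∃partner : ∀ π p → ∃ λ q → ∀ j → exchangeWeight π p q j ≡ 0
  ∃partner π p = let q , W≡0 = sumFin<n⇒∃≡0 _ ΣΣW<n in q , sumFin≡0⇒≡0 _ W≡0
    where
    open ≤-Reasoning
    four : ∀ k → (k + k) + (k + k) ≡ 4 * k
    four = solve-∀

    ΣW≤ : ∀ j → sumFin n (λ q → exchangeWeight π p q j) ≤ 4 * K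
    ΣW≤ j = ≤-trans
      (sumFin-+-≤ (λ q → f₁ q + f₂ q) (λ q → f₃ q + f₄ q)
        (sumFin-+-≤ f₁ f₂ (column-permute π _) (column-permute π _))
        (sumFin-+-≤ f₃ f₄ (column-permute (D j ∘ₚ π) _) (column-permute (flip (D j) ∘ₚ π) _)))
      (≤-reflexive (four K))
      where
      f₁ f₂ f₃ f₄ : Fin n → ℕ
      f₁ q = w (π ⟨$⟩ʳ q) (π ⟨$⟩ʳ (D j ⟨$⟩ʳ p))
      f₂ q = w (π ⟨$⟩ʳ q) (π ⟨$⟩ʳ (D j ⟨$⟩ˡ p))
      f₃ q = w (π ⟨$⟩ʳ (D j ⟨$⟩ʳ q)) (π ⟨$⟩ʳ p)
      f₄ q = w (π ⟨$⟩ʳ (D j ⟨$⟩ˡ q)) (π ⟨$⟩ʳ p)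

    ΣΣW<n : sumFin n (λ q → sumFin m (exchangeWeight π p q)) < n
    ΣΣW<n = begin-strict
      sumFin n (λ q → sumFin m (exchangeWeight π p q))          ≡⟨ sumFin-swap (exchangeWeight π p) ⟩
      sumFin m (λ j → sumFin n (λ q → exchangeWeight π p q j))  ≤⟨ sumFin-mono-≤ ΣW≤ ⟩
      sumFin m (λ _ → 4 * K)                                    ≡⟨ sumFin-const m (4 * K) ⟩
      m * (4 * K)                                               <⟨ large ⟩
      n                                                         ∎

  module _ (π : Permutation′ n) (p q : Fin n) (W≡0 : ∀ j → exchangeWeight π p q j ≡ 0) where

    exchanged : Permutation′ n
    exchanged = transpose p q ∘ₚ π

    exchanged-p : exchanged ⟨$⟩ʳ p ≡ π ⟨$⟩ʳ q
    exchanged-p = cong (π ⟨$⟩ʳ_) (transpose-first p q)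

    exchanged-q : exchanged ⟨$⟩ʳ q ≡ π ⟨$⟩ʳ p
    exchanged-q = cong (π ⟨$⟩ʳ_) (transpose-second p q)

    exchanged-other : ∀ r → r ≢ p → r ≢ q → exchanged ⟨$⟩ʳ r ≡ π ⟨$⟩ʳ r
    exchanged-other r r≢p r≢q = cong (π ⟨$⟩ʳ_) (transpose-other p q r r≢p r≢q)

    q-Dp : ∀ j → w (π ⟨$⟩ʳ q) (π ⟨$⟩ʳ (D j ⟨$⟩ʳ p)) ≡ 0
    q-Dp j = m+n≡0⇒m≡0 _ (m+n≡0⇒m≡0 _ (W≡0 j))

    q-D⁻¹p : ∀ j → w (π ⟨$⟩ʳ q) (π ⟨$⟩ʳ (D j ⟨$⟩ˡ p)) ≡ 0
    q-D⁻¹p j = m+n≡0⇒n≡0 (w _ _) (m+n≡0⇒m≡0 _ (W≡0 j))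

    Dq-p : ∀ j → w (π ⟨$⟩ʳ (D j ⟨$⟩ʳ q)) (π ⟨$⟩ʳ p) ≡ 0
    Dq-p j = m+n≡0⇒m≡0 _ (m+n≡0⇒n≡0 (w _ _ + w _ _) (W≡0 j))

    D⁻¹q-p : ∀ j → w (π ⟨$⟩ʳ (D j ⟨$⟩ˡ q)) (π ⟨$⟩ʳ p) ≡ 0
    D⁻¹q-p j = m+n≡0⇒n≡0 (w _ _) (m+n≡0⇒n≡0 (w _ _ + w _ _) (W≡0 j))

    spread-p : Spread exchanged p
    spread-p j = trans (cong₂ w exchanged-p (exchanged-other _ (D-free j p) Dp≢q)) (q-Dp j)
      where
      -- Otherwise the vanishing weight would lie on the diagonal, against `w-refl`.
      Dp≢q : D j ⟨$⟩ʳ p ≢ q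
      Dp≢q eq = w-refl (π ⟨$⟩ʳ q) (subst (λ x → w (π ⟨$⟩ʳ q) (π ⟨$⟩ʳ x) ≡ 0) eq (q-Dp j))

    spread-q : Spread exchanged q
    spread-q j = trans (cong₂ w exchanged-q (exchanged-other _ Dq≢p (D-free j q))) (trans (w-sym _ _) (Dq-p j))
      where
      Dq≢p : D j ⟨$⟩ʳ q ≢ p
      Dq≢p eq = w-refl (π ⟨$⟩ʳ p) (subst (λ x → w (π ⟨$⟩ʳ x) (π ⟨$⟩ʳ p) ≡ 0) eq (Dq-p j))

    -- Only pairs containing `p` or `q` change. Those starting there are covered by `spread-p` and
    -- `spread-q`; those ending there start at a preimage under `D j`, which is why the inverse
    -- terms belong to the exchange weight.
    spread-kept : ∀ r → Spread π r → Spread exchanged r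
    spread-kept r good j = by-cases (r ≟ p) (r ≟ q) (D j ⟨$⟩ʳ r ≟ p) (D j ⟨$⟩ʳ r ≟ q)
      where
      preimage : ∀ {x} → D j ⟨$⟩ʳ r ≡ x → r ≡ D j ⟨$⟩ˡ x
      preimage Dr≡x = trans (sym (inverseˡ (D j))) (cong (D j ⟨$⟩ˡ_) Dr≡x)

      by-cases : Dec (r ≡ p) → Dec (r ≡ q) → Dec (D j ⟨$⟩ʳ r ≡ p) → Dec (D j ⟨$⟩ʳ r ≡ q) →
        w (exchanged ⟨$⟩ʳ r) (exchanged ⟨$⟩ʳ (D j ⟨$⟩ʳ r)) ≡ 0
      by-cases (yes r≡p) _ _ _ = subst (Spread exchanged) (sym r≡p) spread-p j
      by-cases (no _) (yes r≡q) _ _ = subst (Spread exchanged) (sym r≡q) spread-q j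
      by-cases (no r≢p) (no r≢q) (yes Dr≡p) _ =
        trans (cong₂ w (exchanged-other r r≢p r≢q) (trans (cong (exchanged ⟨$⟩ʳ_) Dr≡p) exchanged-p))
          (trans (w-sym _ _) (trans (cong (λ x → w (π ⟨$⟩ʳ q) (π ⟨$⟩ʳ x)) (preimage Dr≡p)) (q-D⁻¹p j)))
      by-cases (no r≢p) (no r≢q) (no _) (yes Dr≡q) =
        trans (cong₂ w (trans (exchanged-other r r≢p r≢q) (cong (π ⟨$⟩ʳ_) (preimage Dr≡q)))
                       (trans (cong (exchanged ⟨$⟩ʳ_) Dr≡q) exchanged-q)) (D⁻¹q-p j)
      by-cases (no r≢p) (no r≢q) (no Dr≢p) (no Dr≢q) =
        trans (cong₂ w (exchanged-other r r≢p r≢q) (exchanged-other _ Dr≢p Dr≢q)) (good j)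

  ∃spread : ∃ λ π → ∀ p → Spread π p
  ∃spread = let π , good = first n ≤-refl in π , λ p → good p (toℕ<n p)
    where
    -- Invariant: all positions below `l` are spread. Repairing position `l` spoils none of them,
    -- even when its partner `q` is one of them.
    first : ∀ l → l ≤ n → ∃ λ π → ∀ p → toℕ p < l → Spread π p
    first zero    _   = idₚ , λ _ ()
    first (suc l) l<n with π , good ← first l (<⇒≤ l<n)
                      with q , W≡0 ← ∃partner π (fromℕ< l<n) = exchanged π p q W≡0 , good′
      where
      p : Fin n
      p = fromℕ< l<n
      good′ : ∀ r → toℕ r < suc l → Spread (exchanged π p q W≡0) r
      good′ r r<1+l with m≤n⇒m<n∨m≡n (≤-pred r<1+l)
      ... | inj₁ r<l = spread-kept π p q W≡0 r (good r r<l)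
      ... | inj₂ r≡l = subst (Spread (exchanged π p q W≡0)) (toℕ-injective (trans (toℕ-fromℕ< l<n) (sym r≡l)))
                       (spread-p π p q W≡0)

-- Rotations of the cyclic order on `Fin n`.

module _ {n : ℕ} .{{_ : NonZero n}} where

  rotate : ℕ → Fin n → Fin n
  rotate k i = (toℕ i + k) mod n

  toℕ-rotate : ∀ k i → toℕ (rotate k i) ≡ (toℕ i + k) % n
  toℕ-rotate k i = toℕ-fromℕ< (m%n<n (toℕ i + k) n)

  rotate-+ : ∀ j k i → rotate j (rotate k i) ≡ rotate (k + j) i
  rotate-+ j k i = toℕ-injective (begin
    toℕ (rotate j (rotate k i))        ≡⟨ toℕ-rotate j _ ⟩
    (toℕ (rotate k i) + j) % n         ≡⟨ cong (λ x → (x + j) % n) (toℕ-rotate k i) ⟩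
    ((toℕ i + k) % n + j) % n          ≡⟨ %-distribˡ-+ ((toℕ i + k) % n) j n ⟩
    ((toℕ i + k) % n % n + j % n) % n  ≡⟨ cong (λ x → (x + j % n) % n) (m%n%n≡m%n (toℕ i + k) n) ⟩
    ((toℕ i + k) % n + j % n) % n      ≡⟨ %-distribˡ-+ (toℕ i + k) j n ⟨
    (toℕ i + k + j) % n                ≡⟨ cong (_% n) (+-assoc (toℕ i) k j) ⟩
    (toℕ i + (k + j)) % n              ≡⟨ toℕ-rotate (k + j) i ⟨
    toℕ (rotate (k + j) i)             ∎)
    where open ≡-Reasoning

  rotate-full : ∀ i → rotate n i ≡ i
  rotate-full i = toℕ-injective (trans (toℕ-rotate n i)
    (trans ([m+n]%n≡m%n (toℕ i) n) (m<n⇒m%n≡m (toℕ<n i))))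

  -- Adding `k` either does not wrap and strictly increases the position, or wraps once and, as
  -- `k < n`, lands strictly below it.
  rotate-free : ∀ k → 0 < k → k < n → ∀ i → rotate k i ≢ i
  rotate-free k 0<k k<n i eq with <-≤-connex (toℕ i + k) n
  ... | inj₁ i+k<n = <-irrefl (sym i+k≡i) (m<m+n (toℕ i) 0<k)
    where
    i+k≡i : toℕ i + k ≡ toℕ i
    i+k≡i = trans (sym (m<n⇒m%n≡m i+k<n)) (trans (sym (toℕ-rotate k i)) (cong toℕ eq))
  ... | inj₂ n≤i+k = <-irrefl l≡i l<i
    where
    l : ℕ
    l = toℕ i + k ∸ n
    l+n : l + n ≡ toℕ i + k
    l+n = m∸n+n≡m n≤i+k
    l<i : l < toℕ i
    l<i = +-cancelʳ-< n l (toℕ i) (≤-<-trans (≤-reflexive l+n) (+-monoʳ-< (toℕ i) k<n))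
    l≡i : l ≡ toℕ i
    l≡i = begin
      l                 ≡⟨ m<n⇒m%n≡m (<-trans l<i (toℕ<n i)) ⟨
      l % n             ≡⟨ [m+n]%n≡m%n l n ⟨
      (l + n) % n       ≡⟨ cong (_% n) l+n ⟩
      (toℕ i + k) % n   ≡⟨ toℕ-rotate k i ⟨
      toℕ (rotate k i)  ≡⟨ cong toℕ eq ⟩
      toℕ i             ∎
      where open ≡-Reasoning

  rotation : ∀ k → k ≤ n → Permutation′ n
  rotation k k≤n = permutation (rotate k) (rotate (n ∸ k))
    (λ i → trans (rotate-+ k (n ∸ k) i) (trans (cong (λ x → rotate x i) (m∸n+n≡m k≤n)) (rotate-full i)))
    (λ i → trans (rotate-+ (n ∸ k) k i) (trans (cong (λ x → rotate x i) (m+[n∸m]≡n k≤n)) (rotate-full i)))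

-- Adding a far cycle to a regular graph

module _ {n d : ℕ} (G : Graph n) (deg : ∀ v → degree G v ≡ d) where

  -- This is the matrix A + I, with A the adjacency matrix; `walks` is its square.
  nearby : Fin n → Fin n → ℕ
  nearby x y = ⟦ does (x ≟ y) ⟧ + ⟦ adj G x y ⟧

  nearby-sym : ∀ x y → nearby x y ≡ nearby y x
  nearby-sym x y = cong₂ (λ a b → ⟦ a ⟧ + ⟦ b ⟧) (does-≟-sym x y) (Graph.sym G x y)

  nearby-refl : ∀ x → nearby x x ≢ 0
  nearby-refl x eq rewrite dec-true (x ≟ x) refl with () ← eq

  adj⇒nearby : ∀ {x y} → adj G x y ≡ true → nearby x y ≢ 0
  adj⇒nearby {x} {y} xy eq rewrite xy with () ← m+n≡0⇒n≡0 ⟦ does (x ≟ y) ⟧ eq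

  sum-nearby : ∀ x → sumFin n (nearby x) ≡ suc d
  sum-nearby x = trans (sumFin-+ (λ y → ⟦ does (x ≟ y) ⟧) (λ y → ⟦ adj G x y ⟧)) (cong₂ _+_ (count-≟ x) (deg x))

  -- Walks of length two with loops allowed: walks x y ≡ 0 says that x and y are
  -- at distance greater than 2.
  walks : Fin n → Fin n → ℕ
  walks x y = sumFin n (λ z → nearby x z * nearby z y)

  walks-sym : ∀ x y → walks x y ≡ walks y x
  walks-sym x y = sumFin-cong (λ z → trans (*-comm (nearby x z) _) (cong₂ _*_ (nearby-sym z y) (nearby-sym x z)))

  walks≢0 : ∀ {x y} z → nearby x z ≢ 0 → nearby z y ≢ 0 → walks x y ≢ 0
  walks≢0 {x} {y} z xz zy eq with m*n≡0⇒m≡0∨n≡0 (nearby x z) (sumFin≡0⇒≡0 (λ z → nearby x z * nearby z y) eq z)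
  ... | inj₁ xz≡0 = xz xz≡0
  ... | inj₂ zy≡0 = zy zy≡0

  walks-refl : ∀ x → walks x x ≢ 0
  walks-refl x = walks≢0 x (nearby-refl x) (nearby-refl x)

  adj⇒walks : ∀ {x y} → adj G x y ≡ true → walks x y ≢ 0
  adj⇒walks {x} xy = walks≢0 x (nearby-refl x) (adj⇒nearby xy)

  -- Squaring a symmetric matrix with constant row sum squares the row sum.
  sum-walks : ∀ y → sumFin n (λ x → walks x y) ≡ suc d * suc d
  sum-walks y = begin
    sumFin n (λ x → walks x y)                                 ≡⟨ sumFin-cong (λ x → walks-sym x y) ⟩
    sumFin n (λ x → sumFin n (λ z → nearby y z * nearby z x))  ≡⟨ sumFin-swap (λ x z → nearby y z * nearby z x) ⟩
    sumFin n (λ z → sumFin n (λ x → nearby y z * nearby z x))  ≡⟨ sumFin-cong (λ z → sumFin-*ˡ (nearby y z) (nearby z)) ⟩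
    sumFin n (λ z → nearby y z * sumFin n (nearby z))          ≡⟨ sumFin-cong (λ z → trans (cong (nearby y z *_) (sum-nearby z)) (*-comm (nearby y z) _)) ⟩
    sumFin n (λ z → suc d * nearby y z)                        ≡⟨ sumFin-*ˡ (suc d) (nearby y) ⟩
    suc d * sumFin n (nearby y)                                ≡⟨ cong (suc d *_) (sum-nearby y) ⟩
    suc d * suc d                                              ∎
    where open ≡-Reasoning

  module _ .{{_ : NonZero n}} (large : 3 * (4 * (suc d * suc d)) < n) where

    private
      3<n : 3 < n
      3<n = ≤-<-trans (m≤m*n 3 (4 * (suc d * suc d))) large

      shift≤3 : ∀ (j : Fin 3) → suc (toℕ j) ≤ 3
      shift≤3 j = toℕ<n j

      shift : Fin 3 → Permutation′ n
      -- The indices 0, 1, 2 stand for the displacements 1, 2, 3.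
      shift j = rotation (suc (toℕ j)) (<⇒≤ (≤-<-trans (shift≤3 j) 3<n))

      ∃π : ∃ λ π → ∀ p → Spread walks walks-sym walks-refl (λ y → ≤-reflexive (sum-walks y)) shift
                           (λ j → rotate-free _ (s≤s z≤n) (≤-<-trans (shift≤3 j) 3<n)) large π p
      ∃π = ∃spread walks walks-sym walks-refl (λ y → ≤-reflexive (sum-walks y)) shift
                           (λ j → rotate-free _ (s≤s z≤n) (≤-<-trans (shift≤3 j) 3<n)) large

    ∃farCycles : ∃ λ (σ : Permutation′ n) → ∀ x →
      walks x (σ ⟨$⟩ʳ x) ≡ 0 × walks x (σ ⟨$⟩ʳ (σ ⟨$⟩ʳ x)) ≡ 0 × walks x (σ ⟨$⟩ʳ (σ ⟨$⟩ʳ (σ ⟨$⟩ʳ x))) ≡ 0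
    ∃farCycles = σ , λ x → far x zero _ refl , far x (suc zero) _ (twice x) , far x (suc (suc zero)) _ (thrice x)
      where
      π σ : Permutation′ n
      π = proj₁ ∃π
      -- `σ` is the rotation by one conjugated by `π`, so its second and third powers are the
      -- conjugated rotations by 2 and 3.
      σ = flip π ∘ₚ (shift zero ∘ₚ π)

      far : ∀ x j y → y ≡ π ⟨$⟩ʳ (shift j ⟨$⟩ʳ (π ⟨$⟩ˡ x)) → walks x y ≡ 0
      far x j y refl = subst (λ x′ → walks x′ y ≡ 0) (inverseʳ π) (proj₂ ∃π (π ⟨$⟩ˡ x) j)

      σ-rotate : ∀ k x → σ ⟨$⟩ʳ (π ⟨$⟩ʳ rotate k (π ⟨$⟩ˡ x)) ≡ π ⟨$⟩ʳ rotate (k + 1) (π ⟨$⟩ˡ x)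
      σ-rotate k x = cong (π ⟨$⟩ʳ_) (trans (cong (rotate 1) (inverseˡ π)) (rotate-+ 1 k _))

      twice : ∀ x → σ ⟨$⟩ʳ (σ ⟨$⟩ʳ x) ≡ π ⟨$⟩ʳ rotate 2 (π ⟨$⟩ˡ x)
      twice x = σ-rotate 1 x

      thrice : ∀ x → σ ⟨$⟩ʳ (σ ⟨$⟩ʳ (σ ⟨$⟩ʳ x)) ≡ π ⟨$⟩ʳ rotate 3 (π ⟨$⟩ˡ x)
      thrice x = trans (cong (σ ⟨$⟩ʳ_) (twice x)) (σ-rotate 2 x)

  module _ (σ : Permutation′ n)
           (far : ∀ x → walks x (σ ⟨$⟩ʳ x) ≡ 0 × walks x (σ ⟨$⟩ʳ (σ ⟨$⟩ʳ x)) ≡ 0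
                      × walks x (σ ⟨$⟩ʳ (σ ⟨$⟩ʳ (σ ⟨$⟩ʳ x))) ≡ 0) where

    private
      s : Fin n → Fin n
      s x = σ ⟨$⟩ʳ x

      far₁ : ∀ x → walks x (s x) ≡ 0
      far₁ x = proj₁ (far x)

      far₂ : ∀ x → walks x (s (s x)) ≡ 0
      far₂ x = proj₁ (proj₂ (far x))

      far₃ : ∀ x → walks x (s (s (s x))) ≡ 0
      far₃ x = proj₂ (proj₂ (far x))

    far⇒≢ : ∀ {x y} → walks x y ≡ 0 → x ≢ y
    far⇒≢ {x} far refl = walks-refl x far

    addCycles : Graph n
    addCycles .adj x y = adj G x y ∨ (does (s x ≟ y) ∨ does (s y ≟ x))
    addCycles .irrefl x rewrite irrefl G x | dec-false (s x ≟ x) (far⇒≢ (far₁ x) ∘ sym) = refl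
    addCycles .Graph.sym x y = cong₂ _∨_ (Graph.sym G x y) (∨-comm (does (s x ≟ y)) _)

    addCycles-adj : ∀ x y → adj addCycles x y ≡ true → adj G x y ≡ true ⊎ s x ≡ y ⊎ s y ≡ x
    addCycles-adj x y xy with adj G x y | s x ≟ y | s y ≟ x
    ... | true  | _        | _        = inj₁ refl
    ... | false | yes sx≡y | _        = inj₂ (inj₁ sx≡y)
    ... | false | no  _    | yes sy≡x = inj₂ (inj₂ sy≡x)
    ... | false | no  _    | no  _    with () ← xy

    -- The disjunction becomes a sum because its three alternatives exclude each other: an edge of
    -- `G` is not a step of `σ` in either direction by `far₁`, and a step is not also a backward
    -- step by `far₂`.
    addCycles-⟦adj⟧ : ∀ x y → ⟦ adj addCycles x y ⟧ ≡ ⟦ adj G x y ⟧ + (⟦ does (s x ≟ y) ⟧ + ⟦ does (s y ≟ x) ⟧)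
    addCycles-⟦adj⟧ x y with adj G x y in xy | s x ≟ y | s y ≟ x
    ... | true  | yes refl | _        = contradiction (far₁ x) (adj⇒walks xy)
    ... | true  | no  _    | yes refl = contradiction (far₁ y) (adj⇒walks (trans (Graph.sym G y x) xy))
    ... | true  | no  _    | no  _    = refl
    ... | false | yes refl | yes ssx≡x = contradiction (sym ssx≡x) (far⇒≢ (far₂ x))
    ... | false | yes _    | no  _    = refl
    ... | false | no  _    | yes _    = refl
    ... | false | no  _    | no  _    = refl

    addCycles-regular : Regular addCycles
    addCycles-regular = d + (1 + 1) , λ x → begin
      sumFin n (λ y → ⟦ adj addCycles x y ⟧)
        ≡⟨ sumFin-cong (addCycles-⟦adj⟧ x) ⟩
      sumFin n (λ y → ⟦ adj G x y ⟧ + (⟦ does (s x ≟ y) ⟧ + ⟦ does (s y ≟ x) ⟧))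
        ≡⟨ sumFin-+ (λ y → ⟦ adj G x y ⟧) (λ y → ⟦ does (s x ≟ y) ⟧ + ⟦ does (s y ≟ x) ⟧) ⟩
      degree G x + sumFin n (λ y → ⟦ does (s x ≟ y) ⟧ + ⟦ does (s y ≟ x) ⟧)
        ≡⟨ cong (degree G x +_) (sumFin-+ (λ y → ⟦ does (s x ≟ y) ⟧) (λ y → ⟦ does (s y ≟ x) ⟧)) ⟩
      degree G x + (countFin n (λ y → does (s x ≟ y)) + countFin n (λ y → does (s y ≟ x)))
        ≡⟨ cong₂ _+_ (deg x) (cong₂ _+_ (count-≟ (s x)) (incoming x)) ⟩
      d + (1 + 1) ∎
      where
      open ≡-Reasoning
      incoming : ∀ x → countFin n (λ y → does (s y ≟ x)) ≡ 1
      -- Reindexing along `σ` turns the predecessors of `x` into the vertices equal to `x`.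
      incoming x = trans (sumFin-permute (λ y → ⟦ does (y ≟ x) ⟧) σ)
        (trans (sumFin-cong (λ y → cong ⟦_⟧ (does-≟-sym y x))) (count-≟ x))

    addCycles-proper : Fin n → ProperSupergraph G addCycles
    addCycles-proper x = (λ i j ij → cong (_∨ (does (s i ≟ j) ∨ does (s j ≟ i))) ij)
                       , x , s x , nonadj , adjacent
      where
      nonadj : adj G x (s x) ≡ false
      nonadj with adj G x (s x) in eq
      ... | true  = contradiction (far₁ x) (adj⇒walks eq)
      ... | false = refl
      adjacent : adj addCycles x (s x) ≡ true
      adjacent rewrite nonadj | dec-true (s x ≟ s x) refl = refl

    -- With one new edge, the two old ones join `x` to `s x`, against `far₁`. Two new edges are
    -- consecutive steps of `σ` whose ends are joined by an old edge, against `far₂`. Three new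
    -- edges form an orbit of length three, against `far₃`.
    new-edge-not-in-triangle : ∀ x z → z ≢ x → z ≢ s x →
      adj addCycles x z ≡ true → adj addCycles (s x) z ≡ true → ⊥
    new-edge-not-in-triangle x z z≢x z≢sx xz sxz with addCycles-adj x z xz | addCycles-adj (s x) z sxz
    ... | inj₁ xz           | inj₁ sxz          = walks≢0 z (adj⇒nearby xz) (adj⇒nearby (trans (Graph.sym G z (s x)) sxz)) (far₁ x)
    ... | inj₁ xz           | inj₂ (inj₁ refl)  = adj⇒walks xz (far₂ x)
    ... | inj₁ _            | inj₂ (inj₂ sz≡sx) = z≢x (trans (sym (inverseˡ σ)) (trans (cong (σ ⟨$⟩ˡ_) sz≡sx) (inverseˡ σ)))
    ... | inj₂ (inj₁ sx≡z)  | _                 = z≢sx (sym sx≡z)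
    ... | inj₂ (inj₂ refl)  | inj₁ ssz          = adj⇒walks (trans (Graph.sym G z (s (s z))) ssz) (far₂ z)
    ... | inj₂ (inj₂ refl)  | inj₂ (inj₁ sssz≡z) = far⇒≢ (far₃ z) (sym sssz≡z)
    ... | inj₂ (inj₂ _)     | inj₂ (inj₂ sz≡sx) = z≢x (trans (sym (inverseˡ σ)) (trans (cong (σ ⟨$⟩ˡ_) sz≡sx) (inverseˡ σ)))

    -- In a clique on at least three vertices every edge lies in a triangle, so no edge of it is
    -- new.
    addCycles-clique : ∀ {k} → ContainsK (3 + k) addCycles → ContainsK (3 + k) G
    addCycles-clique {k} (f , f-inj , clique) = clique⇒ContainsK G f old
      where
      third : ∀ (a b : Fin (3 + k)) → ∃ λ c → c ≢ a × c ≢ b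
      third zero          zero          = suc zero , (λ ()) , λ ()
      third zero          (suc zero)    = suc (suc zero) , (λ ()) , λ ()
      third zero          (suc (suc _)) = suc zero , (λ ()) , λ ()
      third (suc zero)    zero          = suc (suc zero) , (λ ()) , λ ()
      third (suc (suc _)) zero          = suc zero , (λ ()) , λ ()
      third (suc _)       (suc _)       = zero , (λ ()) , λ ()

      not-new : ∀ a b → s (f a) ≢ f b
      not-new a b sfa≡fb with c , c≢a , c≢b ← third a b =
        new-edge-not-in-triangle (f a) (f c) (c≢a ∘ f-inj) (λ eq → c≢b (f-inj (trans eq sfa≡fb)))
          (clique a c (c≢a ∘ sym))
          (subst (λ y → adj addCycles y (f c) ≡ true) (sym sfa≡fb) (clique b c (c≢b ∘ sym)))

      old : ∀ a b → a ≢ b → adj G (f a) (f b) ≡ true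
      old a b a≢b with addCycles-adj (f a) (f b) (clique a b a≢b)
      ... | inj₁ ab        = ab
      ... | inj₂ (inj₁ eq) = contradiction eq (not-new a b)
      ... | inj₂ (inj₂ eq) = contradiction eq (not-new b a)

-- The lower bound on the number of edges.

RegSat⇒n≤ : ∀ {n k} (G : Graph (suc n)) d → (∀ v → degree G v ≡ d) → RegSat (3 + k) G →
  suc n ≤ 3 * (4 * (suc d * suc d))
RegSat⇒n≤ G d deg (_ , free , saturated) = ≮⇒≥ λ large →
  let σ , far = ∃farCycles G deg large in
  free (addCycles-clique G deg σ far
         (saturated (addCycles G deg σ far) (addCycles-regular G deg σ far) (addCycles-proper G deg σ far zero)))

-- For d ≥ 1 the bound n ≤ 12 (d + 1)² gives n ≤ 48 d². Multiplying by n² and substituting n d = 2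
-- e, with e the number of edges, yields n³ ≤ 192 e².
RegSat⇒edges≥ : ∀ {n k} (G : Graph n) → 13 ≤ n → RegSat (3 + k) G → n ^ 3 ≤ 192 * edges G ^ 2
-- Degree zero would leave at most 12 vertices; this is the source of the threshold 13.
RegSat⇒edges≥ {suc n} G 13≤n sat@((zero , deg) , _) = contradiction (≤-trans 13≤n (RegSat⇒n≤ G 0 deg sat)) (<⇒≱ ≤-refl)
RegSat⇒edges≥ {N@(suc _)} G 13≤n sat@((suc e , deg) , _) = begin
  N ^ 3                                                ≡⟨ cube N ⟩
  N * N * N                                            ≤⟨ *-monoʳ-≤ (N * N) (RegSat⇒n≤ G d deg sat) ⟩
  N * N * (3 * (4 * (suc d * suc d)))                  ≤⟨ *-monoʳ-≤ (N * N) (*-monoʳ-≤ 3 (*-monoʳ-≤ 4 (*-mono-≤ 1+d≤2d 1+d≤2d))) ⟩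
  N * N * (3 * (4 * ((2 * d) * (2 * d))))              ≡⟨ regroup N d ⟩
  48 * ((N * d) * (N * d))                             ≡⟨ cong (λ x → 48 * (x * x)) (regular⇒2*edges G d deg) ⟨
  48 * ((2 * edges G) * (2 * edges G))                 ≡⟨ square (edges G) ⟩
  192 * edges G ^ 2                                    ∎
  where
  open ≤-Reasoning
  d : ℕ
  d = suc e
  1+d≤2d : suc d ≤ 2 * d
  1+d≤2d = s≤s (≤-trans (≤-reflexive (+-comm 1 e)) (+-monoʳ-≤ e (s≤s z≤n)))
  cube : ∀ x → x * (x * (x * 1)) ≡ x * x * x
  cube = solve-∀
  regroup : ∀ x y → x * x * (3 * (4 * ((2 * y) * (2 * y)))) ≡ 48 * ((x * y) * (x * y))
  regroup = solve-∀
  square : ∀ x → 48 * ((2 * x) * (2 * x)) ≡ 192 * (x * (x * 1))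
  square = solve-∀

-- Exhaustive search over graphs

-- Enumeration reaches functions only up to pointwise equality, so the predicates searched must
-- respect `_≈_`.
Exhaustible : (A : Set) → (A → A → Set) → Set₁
Exhaustible A _≈_ = ∀ (P : A → Set) → (∀ {x y} → x ≈ y → P x → P y) → (∀ x → Dec (P x)) → Dec (∃ P)

exhaustible-Bool : Exhaustible Bool _≡_
exhaustible-Bool P resp P? with P? true | P? false
... | yes p | _     = yes (true , p)
... | no _  | yes p = yes (false , p)
... | no ¬t | no ¬f = no λ { (true , p) → ¬t p ; (false , p) → ¬f p }

exhaustible-Fin : ∀ {n} → Exhaustible (Fin n) _≡_
exhaustible-Fin P resp P? = any? P?

-- A function on `Fin (suc n)` is, up to `_≈_`, a head followed by a tail: search the heads, and for
-- each head the tails by recursion.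
exhaustible-→ : ∀ {A : Set} {_≈_ : A → A → Set} → (∀ {x} → x ≈ x) → Exhaustible A _≈_ →
  ∀ n → Exhaustible (Fin n → A) (λ f g → ∀ i → f i ≈ g i)
exhaustible-→ ≈-refl exA zero P resp P? with P? (λ ())
... | yes p = yes (_ , p)
... | no ¬p = no λ (f , p) → ¬p (resp (λ ()) p)
exhaustible-→ {A} {_≈_} ≈-refl exA (suc n) P resp P? with exA (λ a → ∃ λ f → P (a ∷ f)) respHead headed?
  where
  open import Data.Vec.Functional using (_∷_)
  respHead : ∀ {a b} → a ≈ b → (∃ λ f → P (a ∷ f)) → ∃ λ f → P (b ∷ f)
  respHead a≈b (f , p) = f , resp (λ { zero → a≈b ; (suc _) → ≈-refl }) p
  headed? : ∀ a → Dec (∃ λ f → P (a ∷ f))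
  headed? a = exhaustible-→ ≈-refl exA n (λ f → P (a ∷ f))
    (λ f≈g → resp (λ { zero → ≈-refl ; (suc i) → f≈g i })) (λ f → P? (a ∷ f))
... | yes (_ , _ , p) = yes (_ , p)
... | no ¬p = no λ (f , p) → ¬p (f zero , f ∘ suc , resp (λ { zero → ≈-refl ; (suc _) → ≈-refl }) p)

_≈ᴳ_ : ∀ {n} → Graph n → Graph n → Set
G ≈ᴳ H = ∀ i j → adj G i j ≡ adj H i j

exhaustible-Graph : ∀ n → Exhaustible (Graph n) _≈ᴳ_
exhaustible-Graph n P resp P? with
  exhaustible-→ (λ _ → refl) (exhaustible-→ refl exhaustible-Bool n) n Realized respRealized realized?
  where
  Realized : (Fin n → Fin n → Bool) → Set
  Realized M = Σ (∀ i → M i i ≡ false) λ irr → Σ (∀ i j → M i j ≡ M j i) λ symm →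
    P (record { adj = M ; irrefl = irr ; sym = symm })
  respRealized : ∀ {M N} → (∀ i j → M i j ≡ N i j) → Realized M → Realized N
  respRealized M≗N (irr , symm , p) =
    (λ i → trans (sym (M≗N i i)) (irr i)) ,
    (λ i j → trans (sym (M≗N i j)) (trans (symm i j) (M≗N j i))) , resp M≗N p
  realized? : ∀ M → Dec (Realized M)
  realized? M with all? (λ i → M i i Bool.≟ false) | all? (λ i → all? (λ j → M i j Bool.≟ M j i))
  ... | no ¬irr | _       = no λ (irr , _) → ¬irr irr
  ... | yes _   | no ¬sym = no λ (_ , symm , _) → ¬sym symm
  ... | yes irr | yes symm with P? (record { adj = M ; irrefl = irr ; sym = symm })
  ...   | yes p = yes (irr , symm , p)
  -- `_≈ᴳ_` compares only adjacencies, so `resp` moves `P` between different proofs of irreflexivity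
  -- and symmetry.
  ...   | no ¬p = no λ (_ , _ , p) → ¬p (resp (λ _ _ → refl) p)
... | yes (M , irr , symm , p) = yes (_ , p)
... | no ¬p = no λ (G , p) → ¬p (adj G , irrefl G , Graph.sym G , resp (λ _ _ → refl) p)

-- Invariance and decidability of graph properties.

≈ᴳ-sym : ∀ {n} {G H : Graph n} → G ≈ᴳ H → H ≈ᴳ G
≈ᴳ-sym G≈H i j = sym (G≈H i j)

ContainsK-mono : ∀ {n k} {G H : Graph n} → (∀ i j → adj G i j ≡ true → adj H i j ≡ true) →
  ContainsK k G → ContainsK k H
ContainsK-mono G⊆H (f , f-inj , clique) = f , f-inj , λ a b a≢b → G⊆H _ _ (clique a b a≢b)

≈ᴳ⇒⊆ : ∀ {n} {G H : Graph n} → G ≈ᴳ H → ∀ i j → adj G i j ≡ true → adj H i j ≡ true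
≈ᴳ⇒⊆ G≈H i j ij = trans (sym (G≈H i j)) ij

ContainsK-resp : ∀ {n k} {G H : Graph n} → G ≈ᴳ H → ContainsK k G → ContainsK k H
ContainsK-resp {G = G} {H} G≈H = ContainsK-mono {G = G} {H} (≈ᴳ⇒⊆ {G = G} {H} G≈H)

Regular-resp : ∀ {n} {G H : Graph n} → G ≈ᴳ H → Regular G → Regular H
Regular-resp G≈H (d , deg) = d , λ v → trans (sumFin-cong (λ j → cong ⟦_⟧ (sym (G≈H v j)))) (deg v)

ProperSupergraph-resp : ∀ {n} {G G′ H H′ : Graph n} → G ≈ᴳ G′ → H ≈ᴳ H′ →
  ProperSupergraph G H → ProperSupergraph G′ H′
ProperSupergraph-resp G≈G′ H≈H′ (G⊆H , i , j , ij∉G , ij∈H) =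
  (λ i j ij → trans (sym (H≈H′ i j)) (G⊆H i j (trans (G≈G′ i j) ij))) ,
  i , j , trans (sym (G≈G′ i j)) ij∉G , trans (sym (H≈H′ i j)) ij∈H

RegSat-resp : ∀ {n k} {G H : Graph n} → G ≈ᴳ H → RegSat k G → RegSat k H
RegSat-resp {G = G} {H} G≈H (reg , free , saturated) =
  Regular-resp {G = G} {H} G≈H reg ,
  free ∘ ContainsK-resp {G = H} {G} (≈ᴳ-sym {G = G} {H} G≈H) ,
  λ H′ reg′ H⊂H′ → saturated H′ reg′
    (ProperSupergraph-resp {G = H} {G} {H′} {H′} (≈ᴳ-sym {G = G} {H} G≈H) (λ _ _ → refl) H⊂H′)

edges-resp : ∀ {n} {G H : Graph n} → G ≈ᴳ H → edges G ≡ edges H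
edges-resp G≈H = sumFin-cong (λ i → sumFin-cong (λ j → cong (λ b → ⟦ (toℕ i <ᵇ toℕ j) ∧ b ⟧) (G≈H i j)))

ContainsK? : ∀ {n} k (G : Graph n) → Dec (ContainsK k G)
ContainsK? k G = map′ (λ (f , clique) → clique⇒ContainsK G f clique) (λ (f , _ , clique) → f , clique)
  (exhaustible-→ refl exhaustible-Fin k Clique respClique
    (λ f → all? (λ a → all? (λ b → ¬? (a ≟ b) →-dec (adj G (f a) (f b) Bool.≟ true)))))
  where
  Clique : (Fin k → _) → Set
  Clique f = ∀ a b → a ≢ b → adj G (f a) (f b) ≡ true
  respClique : ∀ {f g} → f ≗ g → Clique f → Clique g
  respClique f≗g clique a b a≢b = trans (cong₂ (adj G) (sym (f≗g a)) (sym (f≗g b))) (clique a b a≢b)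

Regular? : ∀ {n} (G : Graph n) → Dec (Regular G)
Regular? {zero}  G = yes (0 , λ ())
Regular? {suc n} G = map′ (degree G zero ,_) (λ (d , deg) v → trans (deg v) (sym (deg zero)))
  (all? (λ v → degree G v ℕ.≟ degree G zero))

ProperSupergraph? : ∀ {n} (G H : Graph n) → Dec (ProperSupergraph G H)
ProperSupergraph? G H =
  all? (λ i → all? (λ j → (adj G i j Bool.≟ true) →-dec (adj H i j Bool.≟ true))) ×-dec
  any? (λ i → any? (λ j → (adj G i j Bool.≟ false) ×-dec (adj H i j Bool.≟ true)))

Extends : ∀ {n} → ℕ → Graph n → Graph n → Set
Extends k G H = Regular H × ProperSupergraph G H × ¬ ContainsK k H

∃Extends? : ∀ {n} k (G : Graph n) → Dec (∃ (Extends k G))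
∃Extends? {n} k G = exhaustible-Graph n (Extends k G)
  (λ {H} {H′} H≈H′ (reg , G⊂H , free) → Regular-resp {G = H} {H′} H≈H′ reg ,
    ProperSupergraph-resp {G = G} {G} {H} {H′} (λ _ _ → refl) H≈H′ G⊂H ,
    free ∘ ContainsK-resp {G = H′} {H} (≈ᴳ-sym {G = H} {H′} H≈H′))
  (λ H → Regular? H ×-dec ProperSupergraph? G H ×-dec ¬? (ContainsK? k H))

-- Absence of a clique-free extension gives only a double negation, which decidability of
-- `ContainsK` removes.
¬∃Extends⇒saturated : ∀ {n k} (G : Graph n) → ¬ ∃ (Extends k G) →
  ∀ H → Regular H → ProperSupergraph G H → ContainsK k H
¬∃Extends⇒saturated {k = k} G none H reg G⊂H =
  decidable-stable (ContainsK? k H) λ free → none (H , reg , G⊂H , free)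

RegSat? : ∀ {n} k (G : Graph n) → Dec (RegSat k G)
RegSat? k G = Regular? G ×-dec ¬? (ContainsK? k G) ×-dec
  map′ (¬∃Extends⇒saturated G) (λ saturated (H , reg , G⊂H , free) → free (saturated H reg G⊂H)) (¬? (∃Extends? k G))

-- Saturated extensions and the minimum number of edges.

⟦⟧≤1 : ∀ b → ⟦ b ⟧ ≤ 1
⟦⟧≤1 true  = ≤-refl
⟦⟧≤1 false = z≤n

⟦⟧-mono : ∀ {b c} → (b ≡ true → c ≡ true) → ⟦ b ⟧ ≤ ⟦ c ⟧
⟦⟧-mono {true}  b⇒c rewrite b⇒c refl = ≤-refl
⟦⟧-mono {false} b⇒c = z≤n

countFin≤n : ∀ {n} (p : Fin n → Bool) → countFin n p ≤ n
countFin≤n {n} p = ≤-trans (sumFin-mono-≤ (⟦⟧≤1 ∘ p)) (≤-reflexive (trans (sumFin-const n 1) (*-identityʳ n)))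

ProperSupergraph⇒degree< : ∀ {n} {G H : Graph n} → ProperSupergraph G H → ∃ λ v → degree G v < degree H v
ProperSupergraph⇒degree< {G = G} {H} (G⊆H , i , j , ij∉G , ij∈H) =
  i , sumFin-mono-< (λ l → ⟦⟧-mono (G⊆H i l)) j lt
  where
  lt : ⟦ adj G i j ⟧ < ⟦ adj H i j ⟧
  lt rewrite ij∉G | ij∈H = ≤-refl

-- Regular proper extensions increase the degree, which is at most n.
∃saturatedExtension : ∀ {n k} (G : Graph n) → Regular G → ¬ ContainsK k G →
  ∃ λ H → RegSat k H × (∀ i j → adj G i j ≡ true → adj H i j ≡ true)
∃saturatedExtension {n} {k} G (d , deg) free = go n G d deg (m≤m+n n d) free
  where
  -- `room` is the fuel: it bounds how far the degree can still rise, and every extension uses up at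
  -- least one unit.
  go : ∀ room (G : Graph n) d → (∀ v → degree G v ≡ d) → n ≤ room + d → ¬ ContainsK k G →
    ∃ λ H → RegSat k H × (∀ i j → adj G i j ≡ true → adj H i j ≡ true)
  go room G d deg n≤ free with ∃Extends? k G
  ... | no none = G , ((d , deg) , free , ¬∃Extends⇒saturated G none) , λ _ _ ij → ij
  ... | yes (H , (e , degH) , G⊂H , freeH) with v , lt ← ProperSupergraph⇒degree< {G = G} {H} G⊂H
                                            rewrite deg v | degH v with room
  -- Without room `n ≤ d`, while `H` has a degree above `d` and at most `n`.
  ...   | zero = contradiction (<-≤-trans lt (subst (_≤ n) (degH v) (countFin≤n (adj H v)))) (≤⇒≯ n≤)
  ...   | suc room′ with H′ , sat , H⊆H′ ←
            go room′ H e degH (≤-trans n≤ (≤-trans (≤-reflexive (sym (+-suc room′ d))) (+-monoʳ-≤ room′ lt))) freeH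
          = H′ , sat , λ i j ij → H⊆H′ i j (proj₁ G⊂H i j ij)

-- Descent on the number of edges: exhaustive search decides whether a saturated graph with fewer
-- edges exists, and if none does the current one attains the minimum.
∃minimal : ∀ {n k} (G : Graph n) → RegSat k G → ∃ λ r → r ≤ edges G × IsRRSat n k r
∃minimal {n} {k} G sat = go (edges G) G sat ≤-refl
  where
  Smaller : ℕ → Graph n → Set
  Smaller r H = RegSat k H × edges H < r
  smaller? : ∀ r → Dec (∃ (Smaller r))
  smaller? r = exhaustible-Graph n (Smaller r)
    (λ {H} {H′} H≈H′ (satH , lt) → RegSat-resp {G = H} {H′} H≈H′ satH , subst (_< r) (edges-resp {G = H} {H′} H≈H′) lt)
    (λ H → RegSat? k H ×-dec (edges H <? r))
  go : ∀ fuel (G : Graph n) → RegSat k G → edges G ≤ fuel → ∃ λ r → r ≤ edges G × IsRRSat n k r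
  go fuel G sat ≤fuel with smaller? (edges G)
  ... | no none = edges G , ≤-refl , (G , sat , refl) , λ H satH → ≮⇒≥ λ lt → none (H , satH , lt)
  ... | yes (H , satH , lt) with fuel
  ...   | zero = contradiction (<-≤-trans lt ≤fuel) λ ()
  ...   | suc fuel′ with r , r≤ , min ← go fuel′ H satH (≤-pred (<-≤-trans lt ≤fuel)) = r , ≤-trans r≤ (<⇒≤ lt) , min

-- The degree bound is asked of all clique-free extensions of `B`, since the saturated one is only
-- known to exist. Its common degree d is read off at the given vertex, and 2 e = n d ≤ 2 n D for
-- its e edges.
∃sparseExtension : ∀ {n k D} (B : Graph n) → Regular B → ¬ ContainsK k B → Fin n →
  (∀ G → (∀ i j → adj B i j ≡ true → adj G i j ≡ true) → ¬ ContainsK k G → ∀ v → degree G v ≤ 2 * D) →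
  ∃ λ r → IsRRSat n k r × r ≤ n * D
∃sparseExtension {n} {D = D} B reg free v degree≤ with
  G , sat@((d , deg) , freeG , _) , B⊆G ← ∃saturatedExtension B reg free
  with r , r≤ , minimal ← ∃minimal G sat = r , minimal , ≤-trans r≤ (*-cancelˡ-≤ 2 (begin
    2 * edges G  ≡⟨ regular⇒2*edges G d deg ⟩
    n * d        ≤⟨ *-monoʳ-≤ n (subst (_≤ 2 * D) (deg v) (degree≤ G B⊆G freeG v)) ⟩
    n * (2 * D)  ≡⟨ swap n D ⟩
    2 * (n * D)  ∎))
  where
  open ≤-Reasoning
  swap : ∀ a b → a * (2 * b) ≡ 2 * (a * b)
  swap = solve-∀

-- The sparse construction

sumFin-++ : ∀ m n (f : Fin (m + n) → ℕ) →
  sumFin (m + n) f ≡ sumFin m (λ i → f (i ↑ˡ n)) + sumFin n (λ j → f (m ↑ʳ j))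
sumFin-++ zero    n f = refl
sumFin-++ (suc m) n f = trans (cong (f zero +_) (sumFin-++ m n (f ∘ suc))) (sym (+-assoc (f zero) _ _))

sumFin-combine : ∀ m n (f : Fin (m * n) → ℕ) →
  sumFin (m * n) f ≡ sumFin m (λ i → sumFin n (λ j → f (combine i j)))
sumFin-combine zero    n f = refl
sumFin-combine (suc m) n f = trans (sumFin-++ n (m * n) f)
  (cong (sumFin n (λ j → f (j ↑ˡ (m * n))) +_) (sumFin-combine m n (λ i → f (n ↑ʳ i))))

sumFin-remQuot : ∀ m n (f : Fin m → Fin n → ℕ) →
  sumFin (m * n) (λ i → f (proj₁ (remQuot {m} n i)) (proj₂ (remQuot {m} n i))) ≡ sumFin m (λ i → sumFin n (f i))
sumFin-remQuot m n f = trans (sumFin-combine m n (λ i → f (proj₁ (remQuot {m} n i)) (proj₂ (remQuot {m} n i))))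
  (sumFin-cong (λ i → sumFin-cong (λ j → cong (λ x → f (proj₁ x) (proj₂ x)) (remQuot-combine {m} {n} i j))))

-- Vertices are quadruples (row, column, hue, shade). Adjacent vertices lie in
-- a common row or column; edges along a row change the shade, edges along a
-- column change the hue, and edges inside a cell change both.
module Construction (p t : ℕ) where

  q s order : ℕ
  q = suc p
  s = suc t
  order = q * (q * (s * s))

  V : Set
  V = Fin order

  colTints : V → Fin (q * (s * s))
  colTints v = proj₂ (remQuot {q} (q * (s * s)) v)

  tints : V → Fin (s * s)
  tints v = proj₂ (remQuot {q} (s * s) (colTints v))

  row col : V → Fin q
  row v = proj₁ (remQuot {q} (q * (s * s)) v)
  col v = proj₁ (remQuot {q} (s * s) (colTints v))

  hue shade : V → Fin s
  hue v = proj₁ (remQuot {s} s (tints v))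
  shade v = proj₂ (remQuot {s} s (tints v))

  vertex : Fin q → Fin q → Fin s → Fin s → V
  vertex a b x y = combine a (combine b (combine x y))

  module _ (a b : Fin q) (x y : Fin s) where

    row-vertex : row (vertex a b x y) ≡ a
    row-vertex = cong proj₁ (remQuot-combine a (combine b (combine x y)))

    colTints-vertex : colTints (vertex a b x y) ≡ combine b (combine x y)
    colTints-vertex = cong proj₂ (remQuot-combine a (combine b (combine x y)))

    col-vertex : col (vertex a b x y) ≡ b
    col-vertex = trans (cong (λ c → proj₁ (remQuot {q} (s * s) c)) colTints-vertex) (cong proj₁ (remQuot-combine b (combine x y)))

    tints-vertex : tints (vertex a b x y) ≡ combine x y
    tints-vertex = trans (cong (λ c → proj₂ (remQuot {q} (s * s) c)) colTints-vertex) (cong proj₂ (remQuot-combine b (combine x y)))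

    hue-vertex : hue (vertex a b x y) ≡ x
    hue-vertex = trans (cong (λ c → proj₁ (remQuot {s} s c)) tints-vertex) (cong proj₁ (remQuot-combine x y))

    shade-vertex : shade (vertex a b x y) ≡ y
    shade-vertex = trans (cong (λ c → proj₂ (remQuot {s} s c)) tints-vertex) (cong proj₂ (remQuot-combine x y))

  sum-vertices : ∀ (f : Fin q → Fin q → Fin s → Fin s → ℕ) →
    sumFin order (λ v → f (row v) (col v) (hue v) (shade v)) ≡
    sumFin q (λ a → sumFin q (λ b → sumFin s (λ x → sumFin s (λ y → f a b x y))))
  sum-vertices f = trans
    (sumFin-remQuot q (q * (s * s)) (λ a c → in-row a (proj₁ (remQuot {q} (s * s) c)) (proj₂ (remQuot {q} (s * s) c))))
    (sumFin-cong λ a → trans (sumFin-remQuot q (s * s) (in-row a)) (sumFin-cong λ b → sumFin-remQuot s s (f a b)))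
    where
    in-row : Fin q → Fin q → Fin (s * s) → ℕ
    in-row a b c = f a b (proj₁ (remQuot {s} s c)) (proj₂ (remQuot {s} s c))

  -- A pattern is a relation that depends only on which of the four coordinates agree, `true`
  -- meaning agreement. The number of related vertices is then the same for every vertex, which
  -- gives regularity.
  Pattern : Set
  Pattern = Bool → Bool → Bool → Bool → Bool

  agreement : Pattern → V → V → Bool
  agreement φ v w = φ (does (row v ≟ row w)) (does (col v ≟ col w)) (does (hue v ≟ hue w)) (does (shade v ≟ shade w))

  -- The sum over one coordinate: one value agrees with the given one and `m` values differ.
  over : ℕ → (Bool → ℕ) → ℕ
  over m g = g true + m * g false

  patternCount : Pattern → ℕ
  patternCount φ = over p λ a → over p λ b → over t λ x → over t λ y → ⟦ φ a b x y ⟧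

  count-agreement : ∀ φ v → countFin order (agreement φ v) ≡ patternCount φ
  count-agreement φ v =
    trans (sum-vertices (λ a b x y → ⟦ φ (does (row v ≟ a)) (does (col v ≟ b)) (does (hue v ≟ x)) (does (shade v ≟ y)) ⟧))
    (trans (sumFin-cong λ a → trans (sumFin-cong λ b → trans (sumFin-cong λ x →
        sumFin-does-≟ (shade v) (λ y → ⟦ φ (does (row v ≟ a)) (does (col v ≟ b)) (does (hue v ≟ x)) y ⟧))
        (sumFin-does-≟ (hue v) (λ x → over t λ y → ⟦ φ (does (row v ≟ a)) (does (col v ≟ b)) x y ⟧)))
        (sumFin-does-≟ (col v) (λ b → over t λ x → over t λ y → ⟦ φ (does (row v ≟ a)) b x y ⟧)))
      (sumFin-does-≟ (row v) (λ a → over p λ b → over t λ x → over t λ y → ⟦ φ a b x y ⟧)))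

  edgePattern : Pattern
  edgePattern true  true  x y = not x ∧ not y
  edgePattern true  false _ y = not y
  edgePattern false true  x _ = not x
  edgePattern false false _ _ = false

  base : Graph order
  base .adj = agreement edgePattern
  base .irrefl v rewrite dec-true (row v ≟ row v) refl | dec-true (col v ≟ col v) refl
    | dec-true (hue v ≟ hue v) refl = refl
  base .Graph.sym v w rewrite does-≟-sym (row v) (row w) | does-≟-sym (col v) (col w)
    | does-≟-sym (hue v) (hue w) | does-≟-sym (shade v) (shade w) = refl

  base-regular : Regular base
  base-regular = patternCount edgePattern , count-agreement edgePattern

  same-row⇒shade≢ : ∀ v w → adj base v w ≡ true → row v ≡ row w → shade v ≢ shade w
  same-row⇒shade≢ v w vw rv≡rw sv≡sw
    rewrite dec-true (row v ≟ row w) rv≡rw | dec-true (shade v ≟ shade w) sv≡sw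
    with does (col v ≟ col w) | does (hue v ≟ hue w)
  ... | true  | true  with () ← vw
  ... | true  | false with () ← vw
  ... | false | _     with () ← vw

  same-col⇒hue≢ : ∀ v w → adj base v w ≡ true → col v ≡ col w → hue v ≢ hue w
  same-col⇒hue≢ v w vw cv≡cw hv≡hw
    rewrite dec-true (col v ≟ col w) cv≡cw | dec-true (hue v ≟ hue w) hv≡hw
    with does (row v ≟ row w)
  ... | true  with () ← vw
  ... | false with () ← vw

  row≢⇒col≡ : ∀ v w → adj base v w ≡ true → row v ≢ row w → col v ≡ col w
  row≢⇒col≡ v w vw rv≢rw rewrite dec-false (row v ≟ row w) rv≢rw with col v ≟ col w
  ... | yes cv≡cw = cv≡cw
  ... | no  _     with () ← vw

  rainbow⇒⊥ : ∀ (f : Fin (2 + t) → V) (colour : V → Fin s) →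
    (∀ i j → i ≢ j → colour (f i) ≢ colour (f j)) → ⊥
  rainbow⇒⊥ f colour distinct with i , j , i<j , eq ← pigeonhole ≤-refl (colour ∘ f) =
    distinct i j (λ { refl → <-irrefl refl i<j }) eq

  -- A clique lies in a single line, on which the shade or the hue is a proper
  -- colouring with t + 1 colours.
  base-free : ¬ ContainsK (2 + t) base
  base-free (f , _ , clique) with all? (λ i → row (f i) ≟ row (f zero))
  ... | yes same = rainbow⇒⊥ f shade λ i j i≢j →
          same-row⇒shade≢ (f i) (f j) (clique i j i≢j) (trans (same i) (sym (same j)))
  ... | no differ with k , k≁0 ← ¬∀⟶∃¬ _ _ (λ i → row (f i) ≟ row (f zero)) differ =
          rainbow⇒⊥ f hue λ i j i≢j → same-col⇒hue≢ (f i) (f j) (clique i j i≢j) (trans (col≡ i) (sym (col≡ j)))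
    where
    cross : ∀ i j → row (f i) ≢ row (f j) → col (f i) ≡ col (f j)
    cross i j ri≢rj = row≢⇒col≡ (f i) (f j) (clique i j λ { refl → ri≢rj refl }) ri≢rj
    -- A vertex outside the row of `f zero` shares its column directly; one inside that row is
    -- compared through `k`, which lies outside it.
    col≡ : ∀ i → col (f i) ≡ col (f zero)
    col≡ i with row (f i) ≟ row (f zero)
    ... | no i≁0  = cross i zero i≁0
    ... | yes i~0 = trans (cross i k λ eq → k≁0 (trans (sym eq) i~0)) (cross k zero k≁0)

  adj-in-row : ∀ v w → row v ≡ row w → col v ≢ col w → shade v ≢ shade w → adj base v w ≡ true
  adj-in-row v w r c y rewrite dec-true (row v ≟ row w) r | dec-false (col v ≟ col w) c
    | dec-false (shade v ≟ shade w) y = refl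

  adj-in-col : ∀ v w → row v ≢ row w → col v ≡ col w → hue v ≢ hue w → adj base v w ≡ true
  adj-in-col v w r c x rewrite dec-false (row v ≟ row w) r | dec-true (col v ≟ col w) c
    | dec-false (hue v ≟ hue w) x = refl

  adj-in-cell : ∀ v w → row v ≡ row w → col v ≡ col w → hue v ≢ hue w → shade v ≢ shade w → adj base v w ≡ true
  adj-in-cell v w r c x y rewrite dec-true (row v ≟ row w) r | dec-true (col v ≟ col w) c
    | dec-false (hue v ≟ hue w) x | dec-false (shade v ≟ shade w) y = refl

  -- Two vertices in general position have a common neighbourhood containing t
  -- pairwise adjacent vertices of the cell (row v, col w).
  general-edge⇒ContainsK : ∀ (G : Graph order) → (∀ i j → adj base i j ≡ true → adj G i j ≡ true) →
    ∀ v w → row v ≢ row w → col v ≢ col w → adj G v w ≡ true → ContainsK (2 + t) G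
  general-edge⇒ContainsK G base⊆G v w r≢ c≢ vw = clique⇒ContainsK G f clique
    where
    u : Fin t → V
    -- The hues avoid that of `w`, as edges along the column require, and the shades avoid that of
    -- `v`, as edges along the row require. Both `punchIn` maps are injective, so the chosen
    -- vertices are pairwise adjacent inside the cell.
    u i = vertex (row v) (col w) (punchIn (hue w) i) (punchIn (shade v) i)

    row-u : ∀ i → row (u i) ≡ row v
    row-u i = row-vertex (row v) (col w) (punchIn (hue w) i) (punchIn (shade v) i)
    col-u : ∀ i → col (u i) ≡ col w
    col-u i = col-vertex (row v) (col w) (punchIn (hue w) i) (punchIn (shade v) i)
    hue-u : ∀ i → hue (u i) ≡ punchIn (hue w) i
    hue-u i = hue-vertex (row v) (col w) (punchIn (hue w) i) (punchIn (shade v) i)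
    shade-u : ∀ i → shade (u i) ≡ punchIn (shade v) i
    shade-u i = shade-vertex (row v) (col w) (punchIn (hue w) i) (punchIn (shade v) i)

    vu : ∀ i → adj G v (u i) ≡ true
    vu i = base⊆G _ _ (adj-in-row v (u i) (sym (row-u i)) (λ eq → c≢ (trans eq (col-u i)))
      (λ eq → punchInᵢ≢i (shade v) i (trans (sym (shade-u i)) (sym eq))))

    wu : ∀ i → adj G w (u i) ≡ true
    wu i = base⊆G _ _ (adj-in-col w (u i) (λ eq → r≢ (trans (sym (row-u i)) (sym eq))) (sym (col-u i))
      (λ eq → punchInᵢ≢i (hue w) i (trans (sym (hue-u i)) (sym eq))))

    uu : ∀ i j → i ≢ j → adj G (u i) (u j) ≡ true
    uu i j i≢j = base⊆G _ _ (adj-in-cell (u i) (u j) (trans (row-u i) (sym (row-u j))) (trans (col-u i) (sym (col-u j)))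
      (λ eq → i≢j (punchIn-injective (hue w) i j (trans (sym (hue-u i)) (trans eq (hue-u j)))))
      (λ eq → i≢j (punchIn-injective (shade v) i j (trans (sym (shade-u i)) (trans eq (shade-u j))))))

    f : Fin (2 + t) → V
    f zero          = v
    f (suc zero)    = w
    f (suc (suc i)) = u i

    clique : ∀ a b → a ≢ b → adj G (f a) (f b) ≡ true
    clique zero          zero          a≢b = contradiction refl a≢b
    clique zero          (suc zero)    _   = vw
    clique zero          (suc (suc j)) _   = vu j
    clique (suc zero)    zero          _   = trans (Graph.sym G w v) vw
    clique (suc zero)    (suc zero)    a≢b = contradiction refl a≢b
    clique (suc zero)    (suc (suc j)) _   = wu j
    clique (suc (suc i)) zero          _   = trans (Graph.sym G (u i) v) (vu i)
    clique (suc (suc i)) (suc zero)    _   = trans (Graph.sym G (u i) w) (wu i)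
    clique (suc (suc i)) (suc (suc j)) a≢b = uu i j (a≢b ∘ cong (λ k → suc (suc k)))

  linePattern : Pattern
  linePattern a b _ _ = a ∨ b

  degree≤ : ∀ (G : Graph order) → (∀ i j → adj base i j ≡ true → adj G i j ≡ true) →
    ¬ ContainsK (2 + t) G → ∀ v → degree G v ≤ 2 * (q * (s * s))
  degree≤ G base⊆G free v = begin
    degree G v                              ≤⟨ sumFin-mono-≤ (λ w → ⟦⟧-mono (in-line w)) ⟩
    countFin order (agreement linePattern v) ≡⟨ count-agreement linePattern v ⟩
    -- The row and the column of a cell cover `2 * q` cells minus the shared one. Adding its `s * s`
    -- vertices avoids subtraction; `evaluate` is stated on the unfolded count for the ring solver.
    patternCount linePattern                ≤⟨ m≤m+n _ (s * s) ⟩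
    patternCount linePattern + s * s        ≡⟨ evaluate p t ⟩
    2 * (q * (s * s))                       ∎
    where
    open ≤-Reasoning
    in-line : ∀ w → adj G v w ≡ true → agreement linePattern v w ≡ true
    in-line w vw with row v ≟ row w | col v ≟ col w
    ... | yes _ | _     = refl
    ... | no _  | yes _ = refl
    ... | no r≢ | no c≢ = contradiction (general-edge⇒ContainsK G base⊆G v w r≢ c≢ vw) free
    evaluate : ∀ p t →
      ((1 + t * 1) + t * (1 + t * 1) + p * ((1 + t * 1) + t * (1 + t * 1)))
        + p * ((1 + t * 1) + t * (1 + t * 1) + p * ((0 + t * 0) + t * (0 + t * 0)))
        + (1 + t) * (1 + t)
      ≡ 2 * ((1 + p) * ((1 + t) * (1 + t)))
    evaluate = solve-∀

  ∃sparse : ∃ λ r → IsRRSat order (2 + t) r × r ≤ order * (q * (s * s))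
  ∃sparse = ∃sparseExtension base base-regular base-free zero degree≤

  p≤order : p ≤ order
  p≤order = ≤-trans (n≤1+n p) (m≤m*n q (q * (s * s)))

-- Numerical form of the two bounds.

sparse-estimate : ∀ k q s r → r ≤ q * (q * (s * s)) * (q * (s * s)) →
  k ^ 2 * r ^ 2 ≤ (s * k + 1) ^ 2 * (q * (q * (s * s))) ^ 3
sparse-estimate k q s r r≤ = begin
  k ^ 2 * r ^ 2                            ≤⟨ *-monoʳ-≤ (k ^ 2) (^-monoˡ-≤ 2 r≤) ⟩
  -- Since `n` is the square of `q * s`, the square of `q * (s * s)` is `s ^ 2 * n`.
  k ^ 2 * (n * (q * (s * s))) ^ 2          ≡⟨ regroup k q s ⟩
  (s * k) ^ 2 * n ^ 3                      ≤⟨ *-monoˡ-≤ (n ^ 3) (^-monoˡ-≤ 2 (m≤m+n (s * k) 1)) ⟩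
  (s * k + 1) ^ 2 * n ^ 3                  ∎
  where
  open ≤-Reasoning
  n : ℕ
  n = q * (q * (s * s))
  regroup : ∀ k q s → let c = q * (s * s) ; n = q * c in
    k * (k * 1) * ((n * c) * ((n * c) * 1)) ≡ (s * k) * ((s * k) * 1) * (n * (n * (n * 1)))
  regroup = solve-∀

lower-bound : ∀ t → 1 ≤ t → Σ ℕ λ m → Σ ℕ λ N → ∀ n → N ≤ n → ∀ r → IsRRSat n (t + 2) r → n ^ 3 ≤ m * r ^ 2
-- Having `t` at least 1 gives the clique size the form `3 + k`, so that each of its edges lies in a
-- triangle.
lower-bound (suc t) _ = 192 , 13 , λ n 13≤n r ((G , sat , edges≡r) , _) →
  subst (λ e → n ^ 3 ≤ 192 * e ^ 2) edges≡r
    (RegSat⇒edges≥ G 13≤n (subst (λ k → RegSat k G) (+-comm (suc t) 2) sat))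

-- Divided by `k ^ 2 * n ^ 3`, the inequality says that r / n^(3/2) is at most C + 1/k for
-- arbitrarily large n; over all k this bounds the limit inferior by C.
upper-bound : ∀ t → 1 ≤ t → Σ ℕ λ C → ∀ k → 1 ≤ k → ∀ N →
  Σ ℕ λ n → N ≤ n × (Σ ℕ λ r → IsRRSat n (t + 2) r × k ^ 2 * r ^ 2 ≤ (C * k + 1) ^ 2 * n ^ 3)
-- `C` is the number of hues, and a grid of side `N + 1` has order at least `N`.
upper-bound t _ = suc t , λ k _ N → let open Construction N t ; r , minimal , r≤ = ∃sparse in
  order , p≤order , r , subst (λ l → IsRRSat order l r) (+-comm 2 t) minimal , sparse-estimate k q s r r≤

theorem1p4 : ((t : ℕ) → 1 ≤ t →
    Σ ℕ λ m → Σ ℕ λ N → ∀ (n : ℕ) → N ≤ n → ∀ (r : ℕ) → IsRRSat n (t + 2) r →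
    n ^ 3 ≤ m * r ^ 2)
    ×
    ((t : ℕ) → 1 ≤ t →
    Σ ℕ λ C → ∀ (k : ℕ) → 1 ≤ k → ∀ (N : ℕ) →
    Σ ℕ λ n → N ≤ n × (Σ ℕ λ r → IsRRSat n (t + 2) r ×
    ((k ^ 2) * (r ^ 2) ≤ ((C * k + 1) ^ 2) * (n ^ 3))))
theorem1p4 = lower-bound , upper-bound
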